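{- Suppose that every parametric Presburger family (for every $d\ge1$) has Property 3. Then every parametric Presburger family has Property 3a and Property 3b. (The terms are defined in the context.)
   Context: $\mathbb{N}=\{0,1,2,\dots\}$. A function $g:\mathbb{N}\to\mathbb{Q}$ is a quasi-polynomial if there exist a period $m\ge 1$ and polynomials $p_0,\dots,p_{m-1}\in\mathbb{Q}[t]$ with $g(t)=p_i(t)$ whenever $t\equiv i \bmod m$. A function on $\mathbb{N}$ is eventually a quasi-polynomial if there is $T$ such that it agrees with a quasi-polynomial for all $t\ge T$. A set $A\subseteq\mathbb{N}$ is eventually periodic if there exist $T$ and $m\ge1$ such that for all $t\ge T$, $t\in A\iff t+m\in A$. A family $(S_t)_{t\in\mathbb{N}}$ of subsets of $\mathbb{N}^d$ is a parametric Presburger family if the sets $S_t$ can be defined over the natural numbers (all variables, free and quantified, range over $\mathbb{N}$) by one formula, the same for all $t$, built with quantifiers ($\exists,\forall$), boolean operations (and, or, not), and inequalities of the form $\mathbf{a}(t)\cdot\mathbf{x}\le b(t)$, where $\mathbf{x}$ is the vector of variables (free and quantified), $b\in\mathbb{Z}[t]$, and $\mathbf{a}$ is a vector of polynomials in $\mathbb{Z}[t]$; $t$ is a parameter and is not quantified. The free variables of the formula are the $d$ coordinates of the elements of $S_t$. For a family $(S_t)_{t\in\mathbb{N}}$ of subsets of $\mathbb{N}^d$: Property 3: There exists a function $\mathbf{x}:\mathbb{N}\to\mathbb{N}^d$ such that, if $S_t$ is nonempty, then $\mathbf{x}(t)\in S_t$, and the coordinate functions of $\mathbf{x}$ are eventually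 quasi-polynomials. Moreover, the set of $t$ such that $S_t$ is nonempty is eventually periodic. Property 3a: For every $\mathbf{c}\in\mathbb{Z}^d\setminus\{0\}$, there exists a function $\mathbf{x}:\mathbb{N}\to\mathbb{N}^d$ such that, if $\max_{\mathbf{y}\in S_t}\mathbf{c}\cdot\mathbf{y}$ exists, then it is attained at $\mathbf{x}(t)\in S_t$, and the coordinate functions of $\mathbf{x}$ are eventually quasi-polynomials. Moreover, the set of $t$ such that the maximum exists is eventually periodic. Property 3b: For every $k\in\mathbb{N}$, there exist functions $\mathbf{x}_1,\dots,\mathbf{x}_k:\mathbb{N}\to\mathbb{N}^d$ such that, if $|S_t|\ge k$, then $\mathbf{x}_1(t),\dots,\mathbf{x}_k(t)$ are distinct elements of $S_t$, and the coordinate functions of the $\mathbf{x}_i$ are eventually quasi-polynomials. Moreover, the set of $t$ such that $|S_t|\ge k$ is eventually periodic. -}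

module Defs where

open import Algebra.Bundles.Raw using (RawRing)
open import Data.Fin.Base using (Fin)
open import Data.Integer.Base as ℤ using (ℤ; 0ℤ)
open import Data.List.Base as List using (List)
open import Data.Nat.Base as ℕ using (ℕ; suc; NonZero)
open import Data.Nat.DivMod using (_mod_)
open import Data.Product.Base using (Σ-syntax; ∃-syntax; _×_)
open import Data.Rational.Base as ℚ using (ℚ)
open import Data.Sum.Base using (_⊎_)
open import Data.Vec.Base as Vec using (Vec; _∷_; lookup; zipWith; replicate)
open import Function.Bundles using (_⇔_)
open import Function.Definitions using (Injective)
open import Level using (0ℓ)
open import Relation.Binary.PropositionalEquality.Core using (_≡_; _≢_)
open import Relation.Nullary.Negation.Core using (¬_)
open import Relation.Unary using (Pred; _∈_; Satisfiable)

-- Univariate polynomials as coefficient lists, constant term first;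
-- trailing zeros are allowed.

module Polynomial {c ℓ} (R : RawRing c ℓ) where
  open RawRing R

  Poly : Set c
  Poly = List Carrier

  eval : Poly → Carrier → Carrier
  eval p x = List.foldr (λ a r → a + x * r) 0# p

module ℤ[t] = Polynomial ℤ.+-*-rawRing
module ℚ[t] = Polynomial ℚ.+-*-rawRing

ℕ→ℚ : ℕ → ℚ
ℕ→ℚ n = ℤ.+ n ℚ./ 1

record QuasiPolynomial (g : ℕ → ℚ) : Set where
  field
    period          : ℕ
    .{{period≢0}}   : NonZero period
    constituent     : Fin period → ℚ[t].Poly
    agrees          : ∀ i t → t mod period ≡ i →
                      g t ≡ ℚ[t].eval (constituent i) (ℕ→ℚ t)

EventuallyQuasiPolynomial : (ℕ → ℚ) → Set
EventuallyQuasiPolynomial f =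
  ∃[ g ] QuasiPolynomial g × (∃[ T ] ∀ t → T ℕ.≤ t → f t ≡ g t)

EventuallyPeriodic : Pred ℕ 0ℓ → Set
EventuallyPeriodic A =
  ∃[ T ] ∃[ m ] 1 ℕ.≤ m × (∀ t → T ℕ.≤ t → (t ∈ A ⇔ t ℕ.+ m ∈ A))

EQPCoordinates : ∀ {d} → (ℕ → Vec ℕ d) → Set
EQPCoordinates x = ∀ i → EventuallyQuasiPolynomial (λ t → ℕ→ℚ (lookup (x t) i))

infix 7 _·_

_·_ : ∀ {n} → Vec ℤ n → Vec ℕ n → ℤ
a · x = Vec.foldr _ ℤ._+_ 0ℤ (zipWith (λ aᵢ xᵢ → aᵢ ℤ.* ℤ.+ xᵢ) a x)

-- Formulas with n free variables (de Bruijn: a quantifier binds variable 0).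
-- The atom a ·x≤ b stands for a(t) · x ≤ b(t), with x all variables in scope.

infix  9 _·x≤_
infix  8 ¬′_
infixr 7 _∧′_
infixr 6 _∨′_
infix  5 ∃′_ ∀′_

data Formula (n : ℕ) : Set where
  _·x≤_     : Vec ℤ[t].Poly n → ℤ[t].Poly → Formula n
  _∧′_ _∨′_ : Formula n → Formula n → Formula n
  ¬′_       : Formula n → Formula n
  ∃′_ ∀′_   : Formula (suc n) → Formula n

⟦_⟧ : ∀ {n} → Formula n → ℕ → Pred (Vec ℕ n) 0ℓ
⟦ a ·x≤ b ⟧ t x = Vec.map (λ p → ℤ[t].eval p (ℤ.+ t)) a · x ℤ.≤ ℤ[t].eval b (ℤ.+ t)
⟦ φ ∧′ ψ ⟧  t x = ⟦ φ ⟧ t x × ⟦ ψ ⟧ t x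
⟦ φ ∨′ ψ ⟧  t x = ⟦ φ ⟧ t x ⊎ ⟦ ψ ⟧ t x
⟦ ¬′ φ ⟧    t x = ¬ ⟦ φ ⟧ t x
⟦ ∃′ φ ⟧    t x = ∃[ z ] ⟦ φ ⟧ t (z ∷ x)
⟦ ∀′ φ ⟧    t x = ∀ z → ⟦ φ ⟧ t (z ∷ x)

Family : ℕ → Set₁
Family d = ℕ → Pred (Vec ℕ d) 0ℓ

ParametricPresburger : ∀ {d} → Family d → Set
ParametricPresburger {d} S =
  Σ[ φ ∈ Formula d ] (∀ t x → x ∈ S t ⇔ x ∈ ⟦ φ ⟧ t)

Property3 : ∀ {d} → Family d → Set
Property3 {d} S =
  (Σ[ x ∈ (ℕ → Vec ℕ d) ]
     (∀ t → Satisfiable (S t) → x t ∈ S t) × EQPCoordinates x)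
  × EventuallyPeriodic (λ t → Satisfiable (S t))

record IsMaximum {d} (c : Vec ℤ d) (A : Pred (Vec ℕ d) 0ℓ) (M : ℤ) : Set where
  field
    attained   : ∃[ y ] y ∈ A × c · y ≡ M
    upperBound : ∀ y → y ∈ A → c · y ℤ.≤ M

Property3a : ∀ {d} → Family d → Set
Property3a {d} S = (c : Vec ℤ d) → c ≢ replicate d 0ℤ →
  (Σ[ x ∈ (ℕ → Vec ℕ d) ]
     (∀ t M → IsMaximum c (S t) M → x t ∈ S t × c · x t ≡ M) × EQPCoordinates x)
  × EventuallyPeriodic (λ t → ∃[ M ] IsMaximum c (S t) M)

DistinctElements : ∀ {d} k → Pred (Vec ℕ d) 0ℓ → (Fin k → Vec ℕ d) → Set
DistinctElements k A xs = Injective _≡_ _≡_ xs × (∀ i → xs i ∈ A)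

-- |A| ≥ k, also meaningful for infinite A.
AtLeast : ∀ {d} → ℕ → Pred (Vec ℕ d) 0ℓ → Set
AtLeast k A = ∃[ xs ] DistinctElements k A xs

Property3b : ∀ {d} → Family d → Set
Property3b {d} S = (k : ℕ) →
  (Σ[ x ∈ (Fin k → ℕ → Vec ℕ d) ]
     (∀ t → AtLeast k (S t) → DistinctElements k (S t) (λ i → x i t))
     × (∀ i → EQPCoordinates (x i)))
  × EventuallyPeriodic (λ t → AtLeast k (S t))

{-# OPTIONS --safe #-}

-- Presburger-definable families are closed under boolean operations,
-- quantification and change of variables, and every property in question asks
-- for a point of such a family. The maximisers of c over S_t form the family
-- of y ∈ S_t such that no z ∈ S_t has c · z > c · y. The k-tuples of distinct
-- elements of S_t, laid end to end, form a family in k * d variables. Property 3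
-- for these two families is Property 3a and Property 3b for S.

module Submission where

open import Defs
open import Data.Fin.Base using (Fin; zero; suc; combine; lift; _↑ˡ_)
open import Data.Fin.Properties using (_≟_)
open import Data.Integer.Base as ℤ using (ℤ; 0ℤ; 1ℤ; -1ℤ; +≤+)
open import Data.Integer.Properties as ℤ using (i≤j⇒i-j≤0; i-j≤0⇒i≤j)
open import Data.Integer.Solver using (module +-*-Solver)
open import Data.List.Base using ([]; _∷_)
open import Data.Nat.Base using (ℕ; zero; suc; _+_; _*_; _≤_; z≤n; s≤s)
open import Data.Nat.Properties as ℕ using (*-mono-≤)
open import Data.Product.Base as Product using (Σ-syntax; ∃-syntax; _×_; _,_; proj₁; proj₂)
open import Data.Product.Function.NonDependent.Propositional using (_×-cong_)
open import Data.Sum.Function.Propositional using (_⊎-cong_)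
open import Data.Unit.Base using (tt)
open import Data.Vec.Base using (Vec; []; _∷_; _++_; lookup; map; replicate; tabulate; concat; updateAt)
open import Data.Vec.Properties using (lookup∘tabulate; tabulate∘lookup; tabulate-cong; lookup-++ˡ; lookup-concat; map-∘; map-id; map-cong)
open import Function.Base using (_∘_; id)
open import Function.Bundles using (_⇔_; mk⇔; module Equivalence)
open import Function.Construct.Composition using (_⇔-∘_)
open import Function.Construct.Identity using (⇔-id)
open import Function.Construct.Symmetry using (⇔-sym)
open import Function.Related.TypeIsomorphisms using (¬-cong-⇔)
open import Level using (0ℓ)
open import Relation.Binary.PropositionalEquality
open import Relation.Nullary.Decidable.Core using (Dec; yes; no; decidable-stable)
open import Relation.Nullary.Negation.Core using (¬_; contradiction)
open import Relation.Unary using (Pred; Satisfiable)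

open Equivalence using (to; from)

private
  variable
    d m n : ℕ
    S S′ : Family n
    A B : Set

-- Linear forms

infixl 6 _⊕_

_⊕_ : ℤ[t].Poly → ℤ[t].Poly → ℤ[t].Poly
[]      ⊕ q       = q
(a ∷ p) ⊕ []      = a ∷ p
(a ∷ p) ⊕ (b ∷ q) = (a ℤ.+ b) ∷ (p ⊕ q)

eval-⊕ : ∀ p q x → ℤ[t].eval (p ⊕ q) x ≡ ℤ[t].eval p x ℤ.+ ℤ[t].eval q x
eval-⊕ []      q       x = sym (ℤ.+-identityˡ _)
eval-⊕ (a ∷ p) []      x = sym (ℤ.+-identityʳ _)
eval-⊕ (a ∷ p) (b ∷ q) x rewrite eval-⊕ p q x =
  solve 5 (λ a b x u v → (a :+ b) :+ x :* (u :+ v) := (a :+ x :* u) :+ (b :+ x :* v))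
    refl a b x (ℤ[t].eval p x) (ℤ[t].eval q x)
  where open +-*-Solver

evals : ℕ → Vec ℤ[t].Poly n → Vec ℤ n
evals t = map (λ p → ℤ[t].eval p (ℤ.+ t))

evals-constant : ∀ t (c : Vec ℤ n) → evals t (map (_∷ []) c) ≡ c
evals-constant t c = begin
  evals t (map (_∷ []) c)                      ≡⟨ map-∘ _ _ c ⟨
  map (λ a → a ℤ.+ ℤ.+ t ℤ.* 0ℤ) c             ≡⟨ map-cong constant c ⟩
  map id c                                     ≡⟨ map-id c ⟩
  c                                            ∎
  where
  open ≡-Reasoning
  constant : ∀ a → a ℤ.+ ℤ.+ t ℤ.* 0ℤ ≡ a
  constant a = trans (cong (ℤ._+_ a) (ℤ.*-zeroʳ (ℤ.+ t))) (ℤ.+-identityʳ a)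

++-· : ∀ (a : Vec ℤ m) (b : Vec ℤ n) x y → (a ++ b) · (x ++ y) ≡ a · x ℤ.+ b · y
++-· []      b []      y = sym (ℤ.+-identityˡ _)
++-· (a ∷ as) b (x ∷ xs) y rewrite ++-· as b xs y = sym (ℤ.+-assoc (a ℤ.* ℤ.+ x) _ _)

neg-· : ∀ (a : Vec ℤ n) x → map ℤ.-_ a · x ≡ ℤ.- (a · x)
neg-· []       []       = refl
neg-· (a ∷ as) (x ∷ xs) = begin
  ℤ.- a ℤ.* ℤ.+ x ℤ.+ map ℤ.-_ as · xs   ≡⟨ cong₂ ℤ._+_ (sym (ℤ.neg-distribˡ-* a (ℤ.+ x))) (neg-· as xs) ⟩
  ℤ.- (a ℤ.* ℤ.+ x) ℤ.+ ℤ.- (as · xs)    ≡⟨ ℤ.neg-distrib-+ (a ℤ.* ℤ.+ x) (as · xs) ⟨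
  ℤ.- (a ℤ.* ℤ.+ x ℤ.+ as · xs)          ∎
  where open ≡-Reasoning

-- Change of variables

reindex : (Fin n → Fin m) → Vec A m → Vec A n
reindex ρ x = tabulate (lookup x ∘ ρ)

reindex-++ˡ : ∀ (x : Vec A m) (y : Vec A n) → reindex (_↑ˡ n) (x ++ y) ≡ x
reindex-++ˡ x y = trans (tabulate-cong (lookup-++ˡ x y)) (tabulate∘lookup x)

-- The transpose of `reindex ρ`. As `ρ` may identify variables, coefficients with a common image are
-- added; a position outside the image keeps the zero polynomial `[]`.
pushforward : (Fin n → Fin m) → Vec ℤ[t].Poly n → Vec ℤ[t].Poly m
pushforward ρ []       = replicate _ []
pushforward ρ (a ∷ as) = updateAt (pushforward (ρ ∘ suc) as) (ρ zero) (a ⊕_)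

zeros-· : ∀ t (x : Vec ℕ n) → evals t (replicate n []) · x ≡ 0ℤ
zeros-· t []       = refl
zeros-· t (x ∷ xs) = trans (ℤ.+-identityˡ _) (zeros-· t xs)

updateAt-⊕-· : ∀ t a (as : Vec ℤ[t].Poly n) i x →
  evals t (updateAt as i (a ⊕_)) · x ≡
  ℤ[t].eval a (ℤ.+ t) ℤ.* ℤ.+ lookup x i ℤ.+ evals t as · x
updateAt-⊕-· t a (b ∷ bs) zero (x ∷ xs) rewrite eval-⊕ a b (ℤ.+ t) =
  solve 4 (λ a b x r → (a :+ b) :* x :+ r := a :* x :+ (b :* x :+ r))
    refl (ℤ[t].eval a (ℤ.+ t)) (ℤ[t].eval b (ℤ.+ t)) (ℤ.+ x) (evals t bs · xs)
  where open +-*-Solver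
updateAt-⊕-· t a (b ∷ bs) (suc i) (x ∷ xs) rewrite updateAt-⊕-· t a bs i xs =
  solve 3 (λ u v r → u :+ (v :+ r) := v :+ (u :+ r))
    refl (ℤ[t].eval b (ℤ.+ t) ℤ.* ℤ.+ x) (ℤ[t].eval a (ℤ.+ t) ℤ.* ℤ.+ lookup xs i) (evals t bs · xs)
  where open +-*-Solver

pushforward-· : ∀ t (ρ : Fin n → Fin m) as x →
  evals t (pushforward ρ as) · x ≡ evals t as · reindex ρ x
pushforward-· t ρ []       x = zeros-· t x
pushforward-· t ρ (a ∷ as) x = trans
  (updateAt-⊕-· t a (pushforward (ρ ∘ suc) as) (ρ zero) x)
  (cong (ℤ._+_ (ℤ[t].eval a (ℤ.+ t) ℤ.* ℤ.+ lookup x (ρ zero))) (pushforward-· t (ρ ∘ suc) as x))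

rename : (Fin n → Fin m) → Formula n → Formula m
rename ρ (a ·x≤ b) = pushforward ρ a ·x≤ b
rename ρ (φ ∧′ ψ)  = rename ρ φ ∧′ rename ρ ψ
rename ρ (φ ∨′ ψ)  = rename ρ φ ∨′ rename ρ ψ
rename ρ (¬′ φ)    = ¬′ rename ρ φ
rename ρ (∃′ φ)    = ∃′ rename (lift 1 ρ) φ
rename ρ (∀′ φ)    = ∀′ rename (lift 1 ρ) φ

≡⇒⇔ : A ≡ B → A ⇔ B
≡⇒⇔ refl = ⇔-id _

∃-cong-⇔ : {P Q : A → Set} → (∀ x → P x ⇔ Q x) → (∃[ x ] P x) ⇔ (∃[ x ] Q x)
∃-cong-⇔ P⇔Q = mk⇔ (Product.map₂ (to (P⇔Q _))) (Product.map₂ (from (P⇔Q _)))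

∀-cong-⇔ : {P Q : A → Set} → (∀ x → P x ⇔ Q x) → (∀ x → P x) ⇔ (∀ x → Q x)
∀-cong-⇔ P⇔Q = mk⇔ (λ f x → to (P⇔Q x) (f x)) (λ f x → from (P⇔Q x) (f x))

⟦rename⟧ : ∀ (ρ : Fin n → Fin m) φ t x → ⟦ rename ρ φ ⟧ t x ⇔ ⟦ φ ⟧ t (reindex ρ x)
⟦rename⟧ ρ (a ·x≤ b) t x = ≡⇒⇔ (cong (ℤ._≤ ℤ[t].eval b (ℤ.+ t)) (pushforward-· t ρ a x))
⟦rename⟧ ρ (φ ∧′ ψ)  t x = ⟦rename⟧ ρ φ t x ×-cong ⟦rename⟧ ρ ψ t x
⟦rename⟧ ρ (φ ∨′ ψ)  t x = ⟦rename⟧ ρ φ t x ⊎-cong ⟦rename⟧ ρ ψ t x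
⟦rename⟧ ρ (¬′ φ)    t x = ¬-cong-⇔ (⟦rename⟧ ρ φ t x)
-- `reindex (lift 1 ρ) (z ∷ x)` computes to `z ∷ reindex ρ x`, so the induction hypothesis fits
-- under a binder without transport.
⟦rename⟧ ρ (∃′ φ)    t x = ∃-cong-⇔ λ z → ⟦rename⟧ (lift 1 ρ) φ t (z ∷ x)
⟦rename⟧ ρ (∀′ φ)    t x = ∀-cong-⇔ λ z → ⟦rename⟧ (lift 1 ρ) φ t (z ∷ x)

-- Closure properties of parametric Presburger families

definable-resp-⇔ : (∀ t x → S t x ⇔ S′ t x) → ParametricPresburger S → ParametricPresburger S′
definable-resp-⇔ S⇔S′ (φ , S⇔φ) = φ , λ t x → S⇔φ t x ⇔-∘ ⇔-sym (S⇔S′ t x)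

-- Pulling back along a map of indices covers three later uses at once: adding dummy variables,
-- selecting a block of a long vector, and comparing two coordinates.
definable-reindex : (ρ : Fin n → Fin m) → ParametricPresburger S →
                    ParametricPresburger (λ t x → S t (reindex ρ x))
definable-reindex ρ (φ , S⇔φ) =
  rename ρ φ , λ t x → ⇔-sym (⟦rename⟧ ρ φ t x) ⇔-∘ S⇔φ t (reindex ρ x)

definable-× : ParametricPresburger S → ParametricPresburger S′ →
              ParametricPresburger (λ t x → S t x × S′ t x)
definable-× (φ , S⇔φ) (ψ , S′⇔ψ) = φ ∧′ ψ , λ t x → S⇔φ t x ×-cong S′⇔ψ t x

definable-¬ : ParametricPresburger S → ParametricPresburger (λ t x → ¬ S t x)
definable-¬ (φ , S⇔φ) = ¬′ φ , λ t x → ¬-cong-⇔ (S⇔φ t x)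

definable-∃ : ∀ m (S : Family (m + n)) → ParametricPresburger S →
              ParametricPresburger {n} (λ t y → Σ[ z ∈ Vec ℕ m ] S t (z ++ y))
definable-∃ zero    S S-def =
  definable-resp-⇔ (λ t y → mk⇔ ([] ,_) λ { ([] , p) → p }) S-def
definable-∃ (suc m) S (φ , S⇔φ) =
  definable-resp-⇔
    (λ t y → mk⇔ (λ { (z , a , p) → a ∷ z , p }) (λ { (a ∷ z , p) → z , a , p }))
    -- The head of the vector is de Bruijn variable 0, so `∃′` binds it; the recursion binds the
    -- rest.
    (definable-∃ m (λ t x → ∃[ a ] S t (a ∷ x)) ((∃′ φ) , λ t x → ∃-cong-⇔ λ a → S⇔φ t (a ∷ x)))

-- Later comparisons are brought to this form by moving everything to the left. The entries of `c`
-- become constant polynomials, and `[]` evaluates to the bound 0.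
definable-nonpositive : (c : Vec ℤ n) → ParametricPresburger (λ t x → c · x ℤ.≤ 0ℤ)
definable-nonpositive c =
  (map (_∷ []) c ·x≤ []) ,
  λ t x → ≡⇒⇔ (cong (λ a → a · x ℤ.≤ 0ℤ) (sym (evals-constant t c)))

-- The atom 0 · x ≤ 0 serves as the constant true.
definable-full : A → ParametricPresburger {n} (λ t x → A)
definable-full {n = n} a =
  definable-resp-⇔ (λ t x → mk⇔ (λ _ → a) (λ _ → ℤ.≤-reflexive (0· x)))
    (definable-nonpositive (replicate n 0ℤ))
  where
  0· : ∀ {n} (x : Vec ℕ n) → replicate n 0ℤ · x ≡ 0ℤ
  0· []       = refl
  0· (x ∷ xs) = trans (ℤ.+-identityˡ _) (0· xs)

-- `A` depends on neither `t` nor `x`, so deciding it once makes the implication either true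
-- everywhere or the negation of `S`; `S` itself need not be decidable.
definable-→ : ParametricPresburger S → Dec A → ParametricPresburger (λ t x → S t x → A)
definable-→ S-def (yes a) = definable-resp-⇔ (λ t x → mk⇔ (λ f _ → f) (λ _ → a)) (definable-full a)
definable-→ S-def (no ¬a) =
  definable-resp-⇔ (λ t x → mk⇔ (λ ¬s s → contradiction s ¬s) (λ f s → ¬a (f s)))
    (definable-¬ S-def)

-- The index set is fixed and finite, so this is a finite conjunction and uses no quantifier of the
-- formula language.
definable-∀Fin : ∀ k {P : Fin k → Family n} → (∀ i → ParametricPresburger (P i)) →
                 ParametricPresburger (λ t x → ∀ i → P i t x)
definable-∀Fin zero    P-def = definable-resp-⇔ (λ t x → mk⇔ (λ _ ()) (λ _ → tt)) (definable-full tt)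
definable-∀Fin (suc k) P-def =
  definable-resp-⇔
    (λ t x → mk⇔ (λ { (p , q) → λ { zero → p ; (suc i) → q i } }) (λ f → f zero , f ∘ suc))
    (definable-× (P-def zero) (definable-∀Fin k (P-def ∘ suc)))

definable-lookup-≤ : ∀ i j → ParametricPresburger {n} (λ t x → lookup x i ≤ lookup x j)
definable-lookup-≤ i j =
  definable-resp-⇔ (λ t x → ≤⇔ (lookup x i) (lookup x j))
    (definable-reindex ρ (definable-nonpositive (1ℤ ∷ -1ℤ ∷ [])))
  where
  ρ : Fin 2 → Fin _
  ρ zero       = i
  ρ (suc zero) = j

  ≤⇔ : ∀ a b → (1ℤ ∷ -1ℤ ∷ []) · (a ∷ b ∷ []) ℤ.≤ 0ℤ ⇔ a ≤ b
  ≤⇔ a b = mk⇔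
    (λ p → ℤ.drop‿+≤+ (i-j≤0⇒i≤j (subst (ℤ._≤ 0ℤ) difference p)))
    (λ p → subst (ℤ._≤ 0ℤ) (sym difference) (i≤j⇒i-j≤0 (+≤+ p)))
    where
    difference : (1ℤ ∷ -1ℤ ∷ []) · (a ∷ b ∷ []) ≡ ℤ.+ a ℤ.- ℤ.+ b
    difference = solve 2 (λ a b → con 1ℤ :* a :+ (con -1ℤ :* b :+ con 0ℤ) := a :- b)
      refl (ℤ.+ a) (ℤ.+ b)
      where open +-*-Solver

definable-lookup-≡ : ∀ i j → ParametricPresburger {n} (λ t x → lookup x i ≡ lookup x j)
definable-lookup-≡ i j =
  definable-resp-⇔
    (λ t x → mk⇔ (λ { (p , q) → ℕ.≤-antisym p q }) (λ e → ℕ.≤-reflexive e , ℕ.≤-reflexive (sym e)))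
    (definable-× (definable-lookup-≤ i j) (definable-lookup-≤ j i))

definable-reindex-≡ : (ρ σ : Fin n → Fin m) →
                      ParametricPresburger (λ t x → reindex ρ x ≡ reindex σ x)
definable-reindex-≡ ρ σ =
  definable-resp-⇔
    (λ t x → mk⇔ tabulate-cong λ e i →
      trans (sym (lookup∘tabulate (lookup x ∘ ρ) i))
        (trans (cong (λ v → lookup v i) e) (lookup∘tabulate (lookup x ∘ σ) i)))
    (definable-∀Fin _ λ i → definable-lookup-≡ (ρ i) (σ i))

-- Invariance of eventual periodicity and eventual quasi-polynomiality

periodic-resp-⇔ : {P Q : Pred ℕ 0ℓ} → (∀ t → P t ⇔ Q t) →
                  EventuallyPeriodic P → EventuallyPeriodic Q
periodic-resp-⇔ P⇔Q (T , m , 1≤m , periodic) =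
  T , m , 1≤m , λ t T≤t → P⇔Q (t + m) ⇔-∘ (periodic t T≤t ⇔-∘ ⇔-sym (P⇔Q t))

eqp-resp-≗ : {f g : ℕ → _} → (∀ t → g t ≡ f t) →
             EventuallyQuasiPolynomial f → EventuallyQuasiPolynomial g
eqp-resp-≗ g≗f (h , h-qp , T , f≡h) = h , h-qp , T , λ t T≤t → trans (g≗f t) (f≡h t T≤t)

-- Maxima

-- Optimality is phrased as the absence of a better point, so that it is assembled from negation,
-- projection and one linear inequality.
Maximisers : Vec ℤ d → Family d → Family d
Maximisers c S t y = S t y × ¬ (∃[ z ] S t z × ¬ c · z ℤ.≤ c · y)

definable-Maximisers : ∀ (c : Vec ℤ d) {S : Family d} → ParametricPresburger S →
                       ParametricPresburger (Maximisers c S)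
definable-Maximisers {d} c {S} S-def =
  definable-× S-def (definable-¬ (definable-resp-⇔ (λ t y → ∃-cong-⇔ (better t y))
    (definable-∃ d _
      -- In `z ++ y` the competitor `z` comes first: `_↑ˡ d` selects it, and the coefficients `c`
      -- followed by their negatives give c · z - c · y.
      (definable-× (definable-reindex (_↑ˡ d) S-def)
        (definable-¬ (definable-nonpositive (c ++ map ℤ.-_ c)))))))
  where
  difference : ∀ z y → (c ++ map ℤ.-_ c) · (z ++ y) ≡ c · z ℤ.- c · y
  difference z y = trans (++-· c _ z y) (cong (ℤ._+_ (c · z)) (neg-· c y))

  better : ∀ t y z →
    (S t (reindex (_↑ˡ d) (z ++ y)) × ¬ (c ++ map ℤ.-_ c) · (z ++ y) ℤ.≤ 0ℤ) ⇔
    (S t z × ¬ c · z ℤ.≤ c · y)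
  better t y z =
    ≡⇒⇔ (cong (S t) (reindex-++ˡ z y)) ×-cong ¬-cong-⇔ (mk⇔
      (λ p → i-j≤0⇒i≤j (subst (ℤ._≤ 0ℤ) (difference z y) p))
      (λ p → subst (ℤ._≤ 0ℤ) (sym (difference z y)) (i≤j⇒i-j≤0 p)))

maximiser⇒maximum : ∀ (c : Vec ℤ d) S {t y} → Maximisers c S t y → IsMaximum c (S t) (c · y)
maximiser⇒maximum c S {y = y} (y∈S , none) = record
  { attained   = y , y∈S , refl
  -- Decidability of ≤ on the integers turns "no point is better" back into an upper bound.
  ; upperBound = λ z z∈S → decidable-stable (c · z ℤ.≤? c · y) λ ≰ → none (z , z∈S , ≰)
  }

maximum⇒maximiser : ∀ (c : Vec ℤ d) S {t M} → IsMaximum c (S t) M → ∃[ y ] Maximisers c S t y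
maximum⇒maximiser c S max with IsMaximum.attained max
... | y , y∈S , refl = y , y∈S , λ (z , z∈S , ≰) → ≰ (IsMaximum.upperBound max z z∈S)

-- Each maximum is attained, hence bounded by the other. This is needed because the point that
-- Property 3 selects may differ from the one witnessing `M`.
maximum-unique : ∀ {c : Vec ℤ d} A {M N} → IsMaximum c A M → IsMaximum c A N → M ≡ N
maximum-unique A M-max N-max = ℤ.≤-antisym (below M-max N-max) (below N-max M-max)
  where
  below : ∀ {c : Vec ℤ d} {A M N} → IsMaximum c A M → IsMaximum c A N → M ℤ.≤ N
  below M-max N-max with IsMaximum.attained M-max
  ... | y , y∈A , refl = IsMaximum.upperBound N-max y y∈A

maximisers-property3⇒property3a : (S : Family d) →
  (∀ c → Property3 (Maximisers c S)) → Property3a S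
maximisers-property3⇒property3a S maximisers c _ with maximisers c
... | (x , x-max , x-eqp) , periodic =
  (x , attains , x-eqp) ,
  periodic-resp-⇔
    (λ t → mk⇔ (λ (_ , y-max) → _ , maximiser⇒maximum c S y-max) (maximum⇒maximiser c S ∘ proj₂))
    periodic
  where
  attains : ∀ t M → IsMaximum c (S t) M → S t (x t) × c · x t ≡ M
  attains t M M-max =
    proj₁ maximiser , maximum-unique (S t) (maximiser⇒maximum c S maximiser) M-max
    where maximiser = x-max t (maximum⇒maximiser c S M-max)

-- Tuples of distinct elements

-- `combine i` sends `j` to position i * d + j, the layout that `concat` produces.
block : ∀ {k} → Vec ℕ (k * d) → Fin k → Vec ℕ d
block w i = reindex (combine i) w

block-concat : ∀ {k} (xs : Fin k → Vec ℕ d) i → block (concat (tabulate xs)) i ≡ xs i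
block-concat xs i = begin
  block (concat (tabulate xs)) i             ≡⟨ tabulate-cong (lookup-concat (tabulate xs) i) ⟩
  tabulate (lookup (lookup (tabulate xs) i)) ≡⟨ tabulate∘lookup _ ⟩
  lookup (tabulate xs) i                     ≡⟨ lookup∘tabulate xs i ⟩
  xs i                                       ∎
  where open ≡-Reasoning

DistinctBlocks : ∀ k → Family d → Family (k * d)
DistinctBlocks k S t w = DistinctElements k (S t) (block w)

definable-DistinctBlocks : ∀ k {S : Family d} → ParametricPresburger S →
                           ParametricPresburger (DistinctBlocks k S)
definable-DistinctBlocks k S-def =
  definable-×
    (definable-resp-⇔ (λ t w → mk⇔ (λ f {i} {j} → f i j) (λ f i j → f))
      (definable-∀Fin k λ i → definable-∀Fin k λ j →
        definable-→ (definable-reindex-≡ (combine i) (combine j)) (i ≟ j)))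
    (definable-∀Fin k λ i → definable-reindex (combine i) S-def)

-- Takes the place of function extensionality, since `block-concat` identifies the two tuples only
-- pointwise.
distinct-resp-≗ : ∀ {k} A {xs ys : Fin k → Vec ℕ d} → (∀ i → ys i ≡ xs i) →
                  DistinctElements k A xs → DistinctElements k A ys
distinct-resp-≗ A ys≗xs (injective , ∈A) =
  (λ {i} {j} e → injective (trans (sym (ys≗xs i)) (trans e (ys≗xs j)))) ,
  (λ i → subst A (sym (ys≗xs i)) (∈A i))

atLeast⇔distinctBlocks : ∀ k (S : Family d) t →
  Satisfiable (DistinctBlocks k S t) ⇔ AtLeast k (S t)
atLeast⇔distinctBlocks k S t = mk⇔
  (λ (w , distinct) → block w , distinct)
  (λ (xs , distinct) → concat (tabulate xs) , distinct-resp-≗ (S t) (block-concat xs) distinct)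

-- Zero-tuples would live in dimension 0, where Property 3 is not assumed, so that case is proved
-- directly.
distinctBlocks-property3⇒property3b : (S : Family d) →
  (∀ k → Property3 (DistinctBlocks (suc k) S)) → Property3b S
distinctBlocks-property3⇒property3b S blocks zero =
  -- The empty tuple always qualifies, so the set of parameters is all of ℕ: threshold 0, period 1.
  ((λ ()) , (λ _ _ → (λ { {()} }) , λ ()) , λ ()) ,
  0 , 1 , s≤s z≤n , λ t _ → mk⇔ (λ _ → none (S (t + 1))) (λ _ → none (S t))
  where
  none : ∀ A → AtLeast 0 A
  none A = (λ ()) , (λ { {()} }) , λ ()
distinctBlocks-property3⇒property3b S blocks (suc k) with blocks k
... | (w , w-distinct , w-eqp) , periodic =
  ( (λ i t → block (w t) i)
  , (λ t → w-distinct t ∘ from (atLeast⇔distinctBlocks (suc k) S t))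
  -- Coordinate `j` of the `i`-th point is a coordinate of `w`, so it inherits eventual
  -- quasi-polynomiality.
  , λ i j → eqp-resp-≗ (λ t → cong ℕ→ℚ (lookup∘tabulate (lookup (w t) ∘ combine i) j))
              (w-eqp (combine i j))
  ) ,
  periodic-resp-⇔ (atLeast⇔distinctBlocks (suc k) S) periodic

theorem3p4 : (∀ d → 1 ≤ d → (S : Family d) → ParametricPresburger S → Property3 S) →
    ∀ d → 1 ≤ d → (S : Family d) → ParametricPresburger S → Property3a S × Property3b S
theorem3p4 property3 d 1≤d S S-def =
  maximisers-property3⇒property3a S (λ c →
    property3 d 1≤d (Maximisers c S) (definable-Maximisers c S-def)) ,
  distinctBlocks-property3⇒property3b S (λ k →
    -- The dimension is positive because 1 * 1 ≤ `suc k * d`.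
    property3 (suc k * d) (*-mono-≤ {1} {suc k} (s≤s z≤n) 1≤d) (DistinctBlocks (suc k) S)
      (definable-DistinctBlocks (suc k) S-def))
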